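{- Consider the following ten properties of simplicial complexes: E-, mid-, weakly-, very-weakly-, clique-chordal, and skeleton-E-, skeleton-mid-, skeleton-weakly-, skeleton-very-weakly-, skeleton-clique-chordal. The following implications hold for all simplicial complexes: (1) skeleton-E $\Rightarrow$ skeleton-mid $\Rightarrow$ skeleton-weakly $\Rightarrow$ skeleton-very-weakly $\Rightarrow$ skeleton-clique; (2) E $\Rightarrow$ mid $\Rightarrow$ weakly $\Rightarrow$ very-weakly; (3) mid $\Rightarrow$ clique; (4) skeleton-$X$ $\Rightarrow$ $X$, for each $X\in\{\text{E, mid, weakly, very-weakly, clique}\}$. Moreover this list is maximal up to transitivity: for every dimension $d\ge 2$, and for every ordered pair $(P,Q)$ of distinct properties among the ten such that $P\Rightarrow Q$ does not follow from (1)–(4) by transitivity, there is a $d$-dimensional simplicial complex that satisfies $P$ but not $Q$.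
   Context: Simplicial complexes are finite and not necessarily pure. A vertex labeling of a complex with $n$ vertices is a bijection of its vertices with $[n]$; $\max F$ is the largest label in $F$; the size of a face is its number of vertices. Two faces of the same dimension $k$ are adjacent if their intersection has dimension $k-1$. A complex $\Delta$ is: - E-chordal, if it has a labeling such that for every two facets $F\ne G$ with the same size and same maximum, every subset $H\subseteq F\cup G$ with $|H|=|F|$ is a face of $\Delta$; - mid-chordal, if it has a labeling such that for every two facets $F\neq G$ with the same size and same maximum, $\Delta$ contains every $2$-element subset $e$ of $(F\cup G)\setminus\{\max F\}$ and, for each such $e$, some face $H_e$ with $|H_e|=|F|$ and $e\subseteq H_e\subseteq (F\cup G)\setminus\{\max F\}$; - weakly-chordal, if it has a labeling such that for every two facets $F\ne G$ with the same size and same maximum, $\Delta$ contains some face $H$ with $|H|=|F|$ and $H\subseteq (F\cup G)\setminus\{\max F\}$; - very-weakly-chordal, if it has a labeling such that for every two adjacent facets $F\ne G$ with the same size and same maximum, $(F\cup G)\setminus\{\max F\}$ is a face of $\Delta$; - clique-chordal, if it has a labeling such that for every two facets $F\ne G$ with the same size and same maximum, every $2$-element subset of $F\cup G$ is a face of $\Delta$. The properties skeleton-E-, skeleton-mid-, skeleton-weakly-, skeleton-very-weakly-, skeleton-clique-chordal are defined in the same way, replacing "every two (adjacent) facets $F\ne G$" by "every two (adjacent) faces $f\neq g$ of $\Delta$" (with size $\ge 2$ in the mid and clique cases), with a single labeling working for faces of all sizes. -}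

module Defs where

open import Level using (0ℓ)
open import Data.Nat.Base using (ℕ; suc; _≤_)
open import Data.Fin.Base as Fin using (Fin)
open import Data.Fin.Permutation using (Permutation′; _⟨$⟩ʳ_)
open import Data.Fin.Subset using (Subset; ⁅_⁆; ⊥; _∈_; _⊆_; _∪_; _∩_; _-_; ∣_∣)
open import Data.Product.Base using (∃; ∃-syntax; _×_)
open import Relation.Binary.Core using (Rel)
open import Relation.Binary.PropositionalEquality.Core using (_≡_; _≢_)
open import Relation.Unary using (Pred; Decidable)

-- The vertices are the elements of Fin n. Vertices are faces, and so is the
-- empty set (of dimension -1); being finite, a complex has decidable faces.
record SimplicialComplex : Set₁ where
  field
    n         : ℕ
    Face      : Pred (Subset n) 0ℓ
    face?     : Decidable Face
    ∅-face    : Face ⊥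
    vertex    : ∀ v → Face ⁅ v ⁆
    down      : ∀ {F G} → F ⊆ G → Face G → Face F

  Facet : Pred (Subset n) 0ℓ
  Facet F = Face F × (∀ G → Face G → F ⊆ G → G ≡ F)

  FaceOfSize≥2 : Pred (Subset n) 0ℓ
  FaceOfSize≥2 F = Face F × 2 ≤ ∣ F ∣

  -- A face of size suc k has dimension k.
  HasDimension : ℕ → Set
  HasDimension d = (∃[ F ] Face F × ∣ F ∣ ≡ suc d) × (∀ F → Face F → ∣ F ∣ ≤ suc d)

-- The label set [n] is Fin n, that is {0,…,n-1}; only the order of labels matters.
Labeling : ℕ → Set
Labeling n = Permutation′ n

-- m is the vertex of F whose label is max F.
IsMax : ∀ {n} → Labeling n → Subset n → Fin n → Set
IsMax σ F m = m ∈ F × (∀ v → v ∈ F → σ ⟨$⟩ʳ v Fin.≤ σ ⟨$⟩ʳ m)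

Adjacent : ∀ {n} → Rel (Subset n) 0ℓ
Adjacent F G = ∣ F ∣ ≡ ∣ G ∣ × suc ∣ F ∩ G ∣ ≡ ∣ F ∣

data Kind : Set where
  E mid weakly veryWeakly clique : Kind

data Property : Set where
  plain skeleton : Kind → Property

module _ (Δ : SimplicialComplex) where
  open SimplicialComplex Δ

  -- What is required of two distinct faces F, G of the same size whose
  -- largest label is that of the vertex m.
  Requirement : Kind → (F G : Subset n) (m : Fin n) → Set
  Requirement E F G m =
    ∀ H → H ⊆ F ∪ G → ∣ H ∣ ≡ ∣ F ∣ → Face H
  Requirement mid F G m =
    ∀ e → e ⊆ (F ∪ G) - m → ∣ e ∣ ≡ 2 →
      Face e × (∃[ H ] Face H × ∣ H ∣ ≡ ∣ F ∣ × e ⊆ H × H ⊆ (F ∪ G) - m)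
  Requirement weakly F G m =
    ∃[ H ] Face H × ∣ H ∣ ≡ ∣ F ∣ × H ⊆ (F ∪ G) - m
  Requirement veryWeakly F G m =
    Adjacent F G → Face ((F ∪ G) - m)
  Requirement clique F G m =
    ∀ e → e ⊆ F ∪ G → ∣ e ∣ ≡ 2 → Face e

  Chordal : Kind → Pred (Subset n) 0ℓ → Set
  Chordal X Φ =
    ∃ λ (σ : Labeling n) → ∀ F G m → Φ F → Φ G → F ≢ G → ∣ F ∣ ≡ ∣ G ∣ →
      IsMax σ F m → IsMax σ G m → Requirement X F G m

  Satisfies : Property → Set
  Satisfies (plain X)             = Chordal X Facet
  Satisfies (skeleton E)          = Chordal E Face
  Satisfies (skeleton mid)        = Chordal mid FaceOfSize≥2
  Satisfies (skeleton weakly)     = Chordal weakly Face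
  Satisfies (skeleton veryWeakly) = Chordal veryWeakly Face
  Satisfies (skeleton clique)     = Chordal clique FaceOfSize≥2

infix 4 _⟶_

data _⟶_ : Rel Property 0ℓ where
  skE⟶skMid          : skeleton E          ⟶ skeleton mid
  skMid⟶skWeakly     : skeleton mid        ⟶ skeleton weakly
  skWeakly⟶skVery    : skeleton weakly     ⟶ skeleton veryWeakly
  skVery⟶skClique    : skeleton veryWeakly ⟶ skeleton clique
  E⟶mid              : plain E             ⟶ plain mid
  mid⟶weakly         : plain mid           ⟶ plain weakly
  weakly⟶very        : plain weakly        ⟶ plain veryWeakly
  mid⟶clique         : plain mid           ⟶ plain clique
  skeleton⟶plain     : ∀ X → skeleton X    ⟶ plain X

{-# OPTIONS --safe #-}

-- Except for veryWeakly ⇒ clique on skeleta, the implications hold pair by pair,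
-- by choosing a set of the right size between two given ones.
--
-- A complex fails Q under every labeling as soon as each vertex m lies on two
-- faces that violate Q when m is their maximum: apply this to the vertex with the
-- largest label. Six complexes of dimension 2 on at most 6 vertices have this form
-- of failure while the identity labeling witnesses P; a disjoint simplex raises
-- the dimension to d without affecting either fact. All other separations follow
-- from these six by composing with implications.

module Submission where

open import Defs
open import Data.Bool.Properties using () renaming (_≟_ to _≟ᵇ_)
open import Data.Fin.Base as Fin using (Fin; zero; suc; toℕ; splitAt; join; _↑ˡ_; _↑ʳ_)
open import Data.Fin.Permutation as Perm using (_⟨$⟩ʳ_)
open import Data.Fin.Properties as Fin using (all?; join-splitAt; toℕ-↑ˡ)
open import Data.Fin.Subset
open import Data.Fin.Subset.Properties
open import Data.List.Base using (List; []; _∷_; allFin)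
open import Data.List.Extrema.Nat using (argmax; f[xs]≤f[argmax])
open import Data.List.Membership.Propositional.Properties using (∈-allFin)
open import Data.List.Relation.Unary.All as All using ()
open import Data.List.Relation.Unary.Any as Any using (Any; any?)
open import Data.Nat.Base using (ℕ; zero; suc; _+_; _≤_; _<_; z≤n; s≤s; s≤s⁻¹)
open import Data.Nat.Properties as ℕ using (_≤?_)
open import Data.List.Membership.DecPropositional ℕ._≟_ using () renaming (_∈?_ to _∈ᴸ?_)
open import Data.Product.Base using (Σ; ∃-syntax; _×_; _,_; proj₁)
open import Data.Sum.Base using (_⊎_; inj₁; inj₂; [_,_]′)
open import Data.Vec.Base as Vec using ([]; _∷_; here; there; _++_; tabulate)
open import Data.Vec.Properties
  using (++-injectiveˡ; ++-injectiveʳ; lookup-++ˡ; lookup-++ʳ; []=⇒lookup; lookup⇒[]=; ≡-dec)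
open import Function.Base using (_∘_; id)
open import Level using (0ℓ)
open import Relation.Binary.Construct.Closure.ReflexiveTransitive using (Star; ε; _◅_; _◅◅_; gmap)
open import Relation.Binary.Construct.Closure.Transitive using (TransClosure; [_]; _∷_)
open import Relation.Binary.PropositionalEquality
  using (_≡_; _≢_; refl; sym; trans; cong; subst; subst₂)
open import Relation.Nullary using (¬_; Dec; yes; no; contradiction)
open import Relation.Nullary.Decidable
  using (_×-dec_; _⊎-dec_; _→-dec_; ¬?; map′; decidable-stable; True; toWitness; does)
open import Relation.Unary using (Pred; Decidable)

private variable
  n k : ℕ

-- Cardinalities of finite subsets

⊆∧∣≤∣⇒≡ : ∀ {p q : Subset n} → p ⊆ q → ∣ q ∣ ≤ ∣ p ∣ → p ≡ q
⊆∧∣≤∣⇒≡ {p = []} {[]} _ _ = refl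
⊆∧∣≤∣⇒≡ {p = inside ∷ p} {inside ∷ q} p⊆q le =
  cong (inside ∷_) (⊆∧∣≤∣⇒≡ (drop-∷-⊆ p⊆q) (s≤s⁻¹ le))
⊆∧∣≤∣⇒≡ {p = inside ∷ p} {outside ∷ q} p⊆q _ = contradiction (p⊆q here) λ ()
⊆∧∣≤∣⇒≡ {p = outside ∷ p} {inside ∷ q} p⊆q le =
  contradiction (p⊆q⇒∣p∣≤∣q∣ (drop-∷-⊆ p⊆q)) (ℕ.<⇒≱ le)
⊆∧∣≤∣⇒≡ {p = outside ∷ p} {outside ∷ q} p⊆q le =
  cong (outside ∷_) (⊆∧∣≤∣⇒≡ (drop-∷-⊆ p⊆q) le)

-- A point of `q` outside `p` is left out as long as the rest of `q` still has `k` points; otherwise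
-- `k` is the size of `q` and all of `q` is taken.
interpolate : ∀ {p q : Subset n} k → p ⊆ q → ∣ p ∣ ≤ k → k ≤ ∣ q ∣ →
              ∃[ r ] p ⊆ r × r ⊆ q × ∣ r ∣ ≡ k
interpolate {p = []} {[]} zero _ _ _ = [] , id , id , refl
interpolate {p = inside ∷ p} {outside ∷ q} _ p⊆q _ _ = contradiction (p⊆q here) λ ()
interpolate {p = inside ∷ p} {inside ∷ q} (suc k) p⊆q p≤k k≤q
  with r , p⊆r , r⊆q , eq ← interpolate k (drop-∷-⊆ p⊆q) (s≤s⁻¹ p≤k) (s≤s⁻¹ k≤q) =
  inside ∷ r , s⊆s p⊆r , s⊆s r⊆q , cong suc eq
interpolate {p = outside ∷ p} {outside ∷ q} k p⊆q p≤k k≤q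
  with r , p⊆r , r⊆q , eq ← interpolate k (drop-∷-⊆ p⊆q) p≤k k≤q =
  outside ∷ r , s⊆s p⊆r , s⊆s r⊆q , eq
interpolate {p = outside ∷ p} {inside ∷ q} k p⊆q p≤k k≤1+q with k ≤? ∣ q ∣
... | yes k≤q with r , p⊆r , r⊆q , eq ← interpolate k (drop-∷-⊆ p⊆q) p≤k k≤q =
  outside ∷ r , s⊆s p⊆r , out⊆ r⊆q , eq
... | no k≰q = inside ∷ q , p⊆q , id , ℕ.≤-antisym (ℕ.≰⇒> k≰q) k≤1+q

∣p∣≤1+∣p-x∣ : ∀ (p : Subset n) x → ∣ p ∣ ≤ suc ∣ p - x ∣
∣p∣≤1+∣p-x∣ (inside  ∷ p) Fin.zero = s≤s (ℕ.≤-reflexive (cong ∣_∣ (sym (p─⊥≡p p))))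
∣p∣≤1+∣p-x∣ (outside ∷ p) Fin.zero =
  ℕ.m≤n⇒m≤1+n (ℕ.≤-reflexive (cong ∣_∣ (sym (p─⊥≡p p))))
∣p∣≤1+∣p-x∣ (inside  ∷ p) (Fin.suc x) = s≤s (∣p∣≤1+∣p-x∣ p x)
∣p∣≤1+∣p-x∣ (outside ∷ p) (Fin.suc x) = ∣p∣≤1+∣p-x∣ p x

∣p∪q∣+∣p∩q∣ : ∀ (p q : Subset n) → ∣ p ∪ q ∣ + ∣ p ∩ q ∣ ≡ ∣ p ∣ + ∣ q ∣
∣p∪q∣+∣p∩q∣ [] [] = refl
∣p∪q∣+∣p∩q∣ (inside  ∷ p) (inside  ∷ q)
  rewrite ℕ.+-suc ∣ p ∪ q ∣ ∣ p ∩ q ∣ | ℕ.+-suc ∣ p ∣ ∣ q ∣ =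
  cong (2 +_) (∣p∪q∣+∣p∩q∣ p q)
∣p∪q∣+∣p∩q∣ (inside  ∷ p) (outside ∷ q) = cong suc (∣p∪q∣+∣p∩q∣ p q)
∣p∪q∣+∣p∩q∣ (outside ∷ p) (inside  ∷ q)
  rewrite ℕ.+-suc ∣ p ∣ ∣ q ∣ = cong suc (∣p∪q∣+∣p∩q∣ p q)
∣p∪q∣+∣p∩q∣ (outside ∷ p) (outside ∷ q) = ∣p∪q∣+∣p∩q∣ p q

x∈p-y⇒x≢y : ∀ {x y} (p : Subset n) → x ∈ p - y → x ≢ y
x∈p-y⇒x≢y {x = x} p x∈ refl = x∉p─⁅x⁆ p x x∈
  where
  x∉p─⁅x⁆ : ∀ {n} (p : Subset n) x → x ∉ p - x
  x∉p─⁅x⁆ (_ ∷ p) Fin.zero ()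
  x∉p─⁅x⁆ (_ ∷ p) (Fin.suc x) (there x∈) = x∉p─⁅x⁆ p x x∈

0<∣p∣⇒Nonempty : ∀ (p : Subset n) → 0 < ∣ p ∣ → Nonempty p
0<∣p∣⇒Nonempty (inside  ∷ p) _ = Fin.zero , here
0<∣p∣⇒Nonempty (outside ∷ p) 0<p with x , x∈p ← 0<∣p∣⇒Nonempty p 0<p = Fin.suc x , there x∈p

pair⊆ : ∀ {x y} {q : Subset n} → x ∈ q → y ∈ q → ⁅ x ⁆ ∪ ⁅ y ⁆ ⊆ q
pair⊆ {x = x} {y} x∈q y∈q z∈ with x∈p∪q⁻ ⁅ x ⁆ ⁅ y ⁆ z∈
... | inj₁ z∈x rewrite x∈⁅y⁆⇒x≡y x z∈x = x∈q
... | inj₂ z∈y rewrite x∈⁅y⁆⇒x≡y y z∈y = y∈q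

∈-pairˡ : ∀ (x y : Fin n) → x ∈ ⁅ x ⁆ ∪ ⁅ y ⁆
∈-pairˡ x y = x∈p∪q⁺ (inj₁ (x∈⁅x⁆ x))

∈-pairʳ : ∀ (x y : Fin n) → y ∈ ⁅ x ⁆ ∪ ⁅ y ⁆
∈-pairʳ x y = x∈p∪q⁺ (inj₂ (x∈⁅x⁆ y))

∈-pair⁻ : ∀ (x y : Fin n) {z} → z ∈ ⁅ x ⁆ ∪ ⁅ y ⁆ → z ≡ x ⊎ z ≡ y
∈-pair⁻ x y z∈ with x∈p∪q⁻ ⁅ x ⁆ ⁅ y ⁆ z∈
... | inj₁ z∈x = inj₁ (x∈⁅y⁆⇒x≡y x z∈x)
... | inj₂ z∈y = inj₂ (x∈⁅y⁆⇒x≡y y z∈y)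

∣pair∣≡2 : ∀ {x y : Fin n} → x ≢ y → ∣ ⁅ x ⁆ ∪ ⁅ y ⁆ ∣ ≡ 2
∣pair∣≡2 {n} {x} {y} x≢y = trans (sym (ℕ.+-identityʳ _))
  (trans (cong (∣ ⁅ x ⁆ ∪ ⁅ y ⁆ ∣ +_) (sym ∣∩∣≡0))
  (trans (∣p∪q∣+∣p∩q∣ ⁅ x ⁆ ⁅ y ⁆)
  (trans (cong (_+ ∣ ⁅ y ⁆ ∣) (∣⁅x⁆∣≡1 x)) (cong suc (∣⁅x⁆∣≡1 y)))))
  where
  disjoint : Empty (⁅ x ⁆ ∩ ⁅ y ⁆)
  disjoint (z , z∈) with z∈x , z∈y ← x∈p∩q⁻ ⁅ x ⁆ ⁅ y ⁆ z∈ =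
    x≢y (trans (sym (x∈⁅y⁆⇒x≡y x z∈x)) (x∈⁅y⁆⇒x≡y y z∈y))
  ∣∩∣≡0 : ∣ ⁅ x ⁆ ∩ ⁅ y ⁆ ∣ ≡ 0
  ∣∩∣≡0 = trans (cong ∣_∣ (Empty-unique disjoint)) (∣⊥∣≡0 n)

pair-with : ∀ {p : Subset n} {x} → ∣ p ∣ ≡ 2 → x ∈ p →
            ∃[ y ] x ≢ y × p ≡ ⁅ x ⁆ ∪ ⁅ y ⁆
pair-with {p = p} {x} ∣p∣≡2 x∈p
  with y , y∈p-x ← 0<∣p∣⇒Nonempty (p - x)
                     (s≤s⁻¹ (subst (_≤ suc ∣ p - x ∣) ∣p∣≡2 (∣p∣≤1+∣p-x∣ p x))) =
  y , x≢y , sym (⊆∧∣≤∣⇒≡ (pair⊆ x∈p (p─q⊆p p ⁅ x ⁆ y∈p-x))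
                         (ℕ.≤-reflexive (trans ∣p∣≡2 (sym (∣pair∣≡2 x≢y)))))
  where
  x≢y : x ≢ y
  x≢y = x∈p-y⇒x≢y p y∈p-x ∘ sym

module _ {F G : Subset n} {m : Fin n}
         (F≢G : F ≢ G) (∣F∣≡∣G∣ : ∣ F ∣ ≡ ∣ G ∣) (m∈F : m ∈ F) (m∈G : m ∈ G) where

  -- Distinct sets of equal size have a strictly larger union, and deleting `m` costs at most one
  -- point. This is the room for a set `H` of size `∣ F ∣` that avoids `m`.
  ∣F∣≤∣F∪G-m∣ : ∣ F ∣ ≤ ∣ (F ∪ G) - m ∣
  ∣F∣≤∣F∪G-m∣ = s≤s⁻¹ (ℕ.≤-trans (ℕ.≰⇒> ∪≰F) (∣p∣≤1+∣p-x∣ (F ∪ G) m))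
    where
    ∪≰F : ¬ ∣ F ∪ G ∣ ≤ ∣ F ∣
    ∪≰F le = F≢G (sym (⊆∧∣≤∣⇒≡
      (subst (G ⊆_) (sym (⊆∧∣≤∣⇒≡ (p⊆p∪q {p = F} G) le)) (q⊆p∪q F G))
      (ℕ.≤-reflexive ∣F∣≡∣G∣)))

  -- With at most one element, both sets would be `⁅ m ⁆`.
  2≤∣F∣ : 2 ≤ ∣ F ∣
  2≤∣F∣ = ℕ.≰⇒> λ ∣F∣≤1 → F≢G (trans (sym (⁅m⁆≡ m∈F ∣F∣≤1))
                                    (⁅m⁆≡ m∈G (subst (_≤ 1) ∣F∣≡∣G∣ ∣F∣≤1)))
    where
    ⁅m⁆≡ : ∀ {S} → m ∈ S → ∣ S ∣ ≤ 1 → ⁅ m ⁆ ≡ S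
    ⁅m⁆≡ {S} m∈S le = ⊆∧∣≤∣⇒≡
      (λ x∈ → subst (_∈ S) (sym (x∈⁅y⁆⇒x≡y m x∈)) m∈S)
      (subst (∣ S ∣ ≤_) (sym (∣⁅x⁆∣≡1 m)) le)

-- The implications between the ten properties

kind : Property → Kind
kind (plain X)    = X
kind (skeleton X) = X

-- All skeleton properties are given the scope `Face`, also in the mid and clique cases, so that
-- they can be treated uniformly; `Satisfies⇒Chordal` and `Chordal⇒Satisfies` mediate.
scope : Property → (Δ : SimplicialComplex) → Pred (Subset (SimplicialComplex.n Δ)) 0ℓ
scope (plain _)    = SimplicialComplex.Facet
scope (skeleton _) = SimplicialComplex.Face

module _ (Δ : SimplicialComplex) where
  open SimplicialComplex Δ renaming (n to N)

  -- Implication for one pair at a time, free of labelings: through `Chordal-map` it applies under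
  -- every labeling, to facets and to faces alike.
  _⊩_⇒_ : (Φ : Pred (Subset N) 0ℓ) (X Y : Kind) → Set
  Φ ⊩ X ⇒ Y = ∀ F G m → Φ F → Φ G → F ≢ G → ∣ F ∣ ≡ ∣ G ∣ →
    m ∈ F → m ∈ G → Requirement Δ X F G m → Requirement Δ Y F G m

  -- Since 2 ≤ `∣ F ∣` ≤ `∣ (F ∪ G) - m ∣`, the pair `e` can be enlarged to size `∣ F ∣` without
  -- using `m`; the E requirement makes the result a face.
  E⇒mid : Face ⊩ E ⇒ mid
  E⇒mid F G m _ _ F≢G eq m∈F m∈G req e e⊆ ∣e∣≡2
    with H , e⊆H , H⊆ , ∣H∣≡ ← interpolate ∣ F ∣ e⊆
           (subst (_≤ ∣ F ∣) (sym ∣e∣≡2) (2≤∣F∣ F≢G eq m∈F m∈G)) (∣F∣≤∣F∪G-m∣ F≢G eq m∈F m∈G) =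
    down e⊆H H-face , H , H-face , ∣H∣≡ , e⊆H , H⊆
    where
    H-face : Face H
    H-face = req H (p─q⊆p (F ∪ G) ⁅ m ⁆ ∘ H⊆) ∣H∣≡

  -- Any pair in `(F ∪ G) - m` will do; its face `H` is the one sought.
  mid⇒weakly : Face ⊩ mid ⇒ weakly
  mid⇒weakly F G m _ _ F≢G eq m∈F m∈G req
    with e , _ , e⊆ , ∣e∣≡2 ← interpolate 2 (⊥⊆ {p = (F ∪ G) - m})
           (subst (_≤ 2) (sym (∣⊥∣≡0 N)) z≤n)
           (ℕ.≤-trans (2≤∣F∣ F≢G eq m∈F m∈G) (∣F∣≤∣F∪G-m∣ F≢G eq m∈F m∈G))
    with _ , H , H-face , ∣H∣≡ , _ , H⊆ ← req e e⊆ ∣e∣≡2 = H , H-face , ∣H∣≡ , H⊆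

  -- Adjacency leaves at most `∣ F ∣` points in `(F ∪ G) - m`, so the face `H` inside it fills it.
  weakly⇒veryWeakly : Face ⊩ weakly ⇒ veryWeakly
  weakly⇒veryWeakly F G m _ _ F≢G eq m∈F m∈G (H , H-face , ∣H∣≡ , H⊆) (_ , adj) =
    subst Face (⊆∧∣≤∣⇒≡ H⊆ (subst (∣ (F ∪ G) - m ∣ ≤_) (sym ∣H∣≡) ∣∪-m∣≤)) H-face
    where
    ∣∪∣ : ∣ F ∪ G ∣ ≡ suc ∣ F ∣
    ∣∪∣ = ℕ.+-cancelʳ-≡ ∣ F ∩ G ∣ _ _ (trans (∣p∪q∣+∣p∩q∣ F G)
      (trans (cong (∣ F ∣ +_) (trans (sym eq) (sym adj))) (ℕ.+-suc ∣ F ∣ ∣ F ∩ G ∣)))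
    ∣∪-m∣≤ : ∣ (F ∪ G) - m ∣ ≤ ∣ F ∣
    ∣∪-m∣≤ = s≤s⁻¹ (subst (∣ (F ∪ G) - m ∣ <_) ∣∪∣
      (x∈p⇒∣p-x∣<∣p∣ (p⊆p∪q {p = F} G m∈F)))

  -- The other end of `e` lies in `F` or in `G`, and both contain `m`.
  edge-through-max : ∀ {F G e m} → Face F → Face G → m ∈ F → m ∈ G →
                     e ⊆ F ∪ G → ∣ e ∣ ≡ 2 → m ∈ e → Face e
  edge-through-max {F} {G} F-face G-face m∈F m∈G e⊆ ∣e∣≡2 m∈e
    with y , _ , refl ← pair-with ∣e∣≡2 m∈e with x∈p∪q⁻ F G (e⊆ (∈-pairʳ _ y))
  ... | inj₁ y∈F = down (pair⊆ m∈F y∈F) F-face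
  ... | inj₂ y∈G = down (pair⊆ m∈G y∈G) G-face

  mid⇒clique : Face ⊩ mid ⇒ clique
  mid⇒clique F G m F-face G-face F≢G eq m∈F m∈G req e e⊆ ∣e∣≡2 with m ∈? e
  ... | yes m∈e = edge-through-max F-face G-face m∈F m∈G e⊆ ∣e∣≡2 m∈e
  ... | no m∉e = proj₁ (req e
    (λ x∈e → x∈p∧x≢y⇒x∈p-y (e⊆ x∈e) λ { refl → m∉e x∈e }) ∣e∣≡2)

  -- Serves pairs of faces within a simplex, where the E requirement is immediate.
  E⇒ : ∀ X → Face ⊩ E ⇒ X
  E⇒ E   _ _ _ _ _ _ _ _ _ req = req
  E⇒ mid = E⇒mid
  E⇒ weakly F G m F-face G-face F≢G eq m∈F m∈G =
    mid⇒weakly F G m F-face G-face F≢G eq m∈F m∈G ∘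
    E⇒mid F G m F-face G-face F≢G eq m∈F m∈G
  E⇒ veryWeakly F G m F-face G-face F≢G eq m∈F m∈G =
    weakly⇒veryWeakly F G m F-face G-face F≢G eq m∈F m∈G ∘
    mid⇒weakly F G m F-face G-face F≢G eq m∈F m∈G ∘
    E⇒mid F G m F-face G-face F≢G eq m∈F m∈G
  E⇒ clique F G m F-face G-face F≢G eq m∈F m∈G =
    mid⇒clique F G m F-face G-face F≢G eq m∈F m∈G ∘
    E⇒mid F G m F-face G-face F≢G eq m∈F m∈G

  Chordal-map : ∀ X Y {Φ} → (∀ {F} → Φ F → Face F) → Face ⊩ X ⇒ Y →
                Chordal Δ X Φ → Chordal Δ Y Φ
  Chordal-map X Y face X⇒Y (σ , ch) = σ , λ F G m φF φG F≢G eq maxF maxG →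
    X⇒Y F G m (face φF) (face φG) F≢G eq (proj₁ maxF) (proj₁ maxG)
        (ch F G m φF φG F≢G eq maxF maxG)

  Chordal-antimono : ∀ X {Φ Ψ : Pred (Subset N) 0ℓ} → (∀ {F} → Φ F → Ψ F) →
                     Chordal Δ X Ψ → Chordal Δ X Φ
  Chordal-antimono X Φ⊆Ψ (σ , ch) = σ , λ F G m φF φG → ch F G m (Φ⊆Ψ φF) (Φ⊆Ψ φG)

  -- Distinct sets of the same size with a common vertex have at least two elements.
  Chordal-Face : ∀ X → Chordal Δ X FaceOfSize≥2 → Chordal Δ X Face
  Chordal-Face X (σ , ch) = σ , λ F G m F-face G-face F≢G eq maxF maxG →
    let 2≤F = 2≤∣F∣ F≢G eq (proj₁ maxF) (proj₁ maxG) in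
    ch F G m (F-face , 2≤F) (G-face , subst (2 ≤_) eq 2≤F) F≢G eq maxF maxG

  Satisfies⇒Chordal : ∀ P → Satisfies Δ P → Chordal Δ (kind P) (scope P Δ)
  Satisfies⇒Chordal (plain X)             = id
  Satisfies⇒Chordal (skeleton E)          = id
  Satisfies⇒Chordal (skeleton mid)        = Chordal-Face mid
  Satisfies⇒Chordal (skeleton weakly)     = id
  Satisfies⇒Chordal (skeleton veryWeakly) = id
  Satisfies⇒Chordal (skeleton clique)     = Chordal-Face clique

  Chordal⇒Satisfies : ∀ P → Chordal Δ (kind P) (scope P Δ) → Satisfies Δ P
  Chordal⇒Satisfies (plain X)             = id
  Chordal⇒Satisfies (skeleton E)          = id
  Chordal⇒Satisfies (skeleton mid)        = Chordal-antimono mid proj₁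
  Chordal⇒Satisfies (skeleton weakly)     = id
  Chordal⇒Satisfies (skeleton veryWeakly) = id
  Chordal⇒Satisfies (skeleton clique)     = Chordal-antimono clique proj₁

  -- If m is the largest vertex of F ∋ a and of G ∋ b, the adjacent edges {a,m}
  -- and {b,m} force the edge {a,b}.
  skVery⇒skClique : Chordal Δ veryWeakly Face → Chordal Δ clique Face
  skVery⇒skClique (σ , ch) = σ , go
    where
    IsMax-pair : ∀ {F a m} → a ∈ F → IsMax σ F m → IsMax σ (⁅ a ⁆ ∪ ⁅ m ⁆) m
    IsMax-pair {a = a} {m} a∈F (m∈F , max) =
      ∈-pairʳ a m , λ v v∈ → max v (pair⊆ a∈F m∈F v∈)

    mixed : ∀ {F G a b m} → Face F → Face G → a ≢ b → m ∉ ⁅ a ⁆ ∪ ⁅ b ⁆ → a ∈ F → b ∈ G →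
            IsMax σ F m → IsMax σ G m → Face (⁅ a ⁆ ∪ ⁅ b ⁆)
    mixed {F} {G} {a} {b} {m} F-face G-face a≢b m∉ab a∈F b∈G maxF maxG =
      down (pair⊆ (in-union (inj₁ (∈-pairˡ a m)) a≢m) (in-union (inj₂ (∈-pairˡ b m)) b≢m))
        (ch am bm m (down (pair⊆ a∈F (proj₁ maxF)) F-face)
                    (down (pair⊆ b∈G (proj₁ maxG)) G-face)
            am≢bm (trans ∣am∣≡2 (sym (∣pair∣≡2 b≢m)))
            (IsMax-pair a∈F maxF) (IsMax-pair b∈G maxG)
            (trans ∣am∣≡2 (sym (∣pair∣≡2 b≢m)) ,
             trans (cong suc (trans (cong ∣_∣ ∩≡m) (∣⁅x⁆∣≡1 m))) (sym ∣am∣≡2)))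
      where
      am bm : Subset N
      am = ⁅ a ⁆ ∪ ⁅ m ⁆
      bm = ⁅ b ⁆ ∪ ⁅ m ⁆
      a≢m : a ≢ m
      a≢m refl = m∉ab (∈-pairˡ a b)
      b≢m : b ≢ m
      b≢m refl = m∉ab (∈-pairʳ a b)
      ∣am∣≡2 : ∣ am ∣ ≡ 2
      ∣am∣≡2 = ∣pair∣≡2 a≢m
      a∉bm : a ∉ bm
      a∉bm = [ a≢b , a≢m ]′ ∘ ∈-pair⁻ b m
      am≢bm : am ≢ bm
      am≢bm eq = a∉bm (subst (a ∈_) eq (∈-pairˡ a m))
      in-union : ∀ {x} → x ∈ am ⊎ x ∈ bm → x ≢ m → x ∈ (am ∪ bm) - m
      in-union x∈ = x∈p∧x≢y⇒x∈p-y (x∈p∪q⁺ x∈)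
      ∩≡m : am ∩ bm ≡ ⁅ m ⁆
      ∩≡m = ⊆-antisym only-m
        λ x∈ → subst (_∈ am ∩ bm) (sym (x∈⁅y⁆⇒x≡y m x∈)) (x∈p∩q⁺ (∈-pairʳ a m , ∈-pairʳ b m))
        where
        only-m : am ∩ bm ⊆ ⁅ m ⁆
        only-m x∈ with x∈am , x∈bm ← x∈p∩q⁻ am bm x∈ with ∈-pair⁻ a m x∈am
        ... | inj₁ refl = contradiction x∈bm a∉bm
        ... | inj₂ refl = x∈⁅x⁆ m

    go : ∀ F G m → Face F → Face G → F ≢ G → ∣ F ∣ ≡ ∣ G ∣ →
         IsMax σ F m → IsMax σ G m → Requirement Δ clique F G m
    go F G m F-face G-face F≢G eq (m∈F , maxF) (m∈G , maxG) e e⊆ ∣e∣≡2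
      with m ∈? e
    ... | yes m∈e = edge-through-max F-face G-face m∈F m∈G e⊆ ∣e∣≡2 m∈e
    ... | no m∉e
      with a , a∈e ← 0<∣p∣⇒Nonempty e (subst (0 <_) (sym ∣e∣≡2) (s≤s z≤n))
      with b , a≢b , refl ← pair-with ∣e∣≡2 a∈e
      with x∈p∪q⁻ F G (e⊆ a∈e) | x∈p∪q⁻ F G (e⊆ (∈-pairʳ a b))
    ... | inj₁ a∈F | inj₁ b∈F = down (pair⊆ a∈F b∈F) F-face
    ... | inj₂ a∈G | inj₂ b∈G = down (pair⊆ a∈G b∈G) G-face
    ... | inj₁ a∈F | inj₂ b∈G = mixed F-face G-face a≢b m∉e a∈F b∈G (m∈F , maxF) (m∈G , maxG)
    ... | inj₂ a∈G | inj₁ b∈F = mixed G-face F-face a≢b m∉e a∈G b∈F (m∈G , maxG) (m∈F , maxF)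

⟶-sound : ∀ {P Q} → P ⟶ Q → ∀ Δ → Satisfies Δ P → Satisfies Δ Q
⟶-sound {P} {Q} P⟶Q Δ = Chordal⇒Satisfies Δ Q ∘ step P⟶Q ∘ Satisfies⇒Chordal Δ P
  where
  step : ∀ {P Q} → P ⟶ Q → Chordal Δ (kind P) (scope P Δ) → Chordal Δ (kind Q) (scope Q Δ)
  step skE⟶skMid          = Chordal-map Δ E mid id (E⇒mid Δ)
  step skMid⟶skWeakly     = Chordal-map Δ mid weakly id (mid⇒weakly Δ)
  step skWeakly⟶skVery    = Chordal-map Δ weakly veryWeakly id (weakly⇒veryWeakly Δ)
  step skVery⟶skClique    = skVery⇒skClique Δ
  step E⟶mid              = Chordal-map Δ E mid proj₁ (E⇒mid Δ)
  step mid⟶weakly         = Chordal-map Δ mid weakly proj₁ (mid⇒weakly Δ)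
  step weakly⟶very        = Chordal-map Δ weakly veryWeakly proj₁ (weakly⇒veryWeakly Δ)
  step mid⟶clique         = Chordal-map Δ mid clique proj₁ (mid⇒clique Δ)
  step (skeleton⟶plain X) = Chordal-antimono Δ X proj₁

-- Subsets of a disjoint union of vertex sets

∈-++⁺ˡ : ∀ {v} {p : Subset n} {q : Subset k} → v ∈ p → v ↑ˡ k ∈ p ++ q
∈-++⁺ˡ {v = v} {p} {q} v∈ = lookup⇒[]= _ _ (trans (lookup-++ˡ p q v) ([]=⇒lookup v∈))

∈-++⁻ˡ : ∀ {v} {p : Subset n} {q : Subset k} → v ↑ˡ k ∈ p ++ q → v ∈ p
∈-++⁻ˡ {v = v} {p} {q} v∈ = lookup⇒[]= _ _ (trans (sym (lookup-++ˡ p q v)) ([]=⇒lookup v∈))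

∈-++⁺ʳ : ∀ {v} {p : Subset n} {q : Subset k} → v ∈ q → n ↑ʳ v ∈ p ++ q
∈-++⁺ʳ {v = v} {p} {q} v∈ = lookup⇒[]= _ _ (trans (lookup-++ʳ p q v) ([]=⇒lookup v∈))

∈-++⁻ʳ : ∀ {v} {p : Subset n} {q : Subset k} → n ↑ʳ v ∈ p ++ q → v ∈ q
∈-++⁻ʳ {v = v} {p} {q} v∈ = lookup⇒[]= _ _ (trans (sym (lookup-++ʳ p q v)) ([]=⇒lookup v∈))

data Side⊎ {n k} : Fin (n + k) → Set where
  left  : ∀ v → Side⊎ (v ↑ˡ k)
  right : ∀ v → Side⊎ (n ↑ʳ v)

side : ∀ n {k} (v : Fin (n + k)) → Side⊎ {n} v
side n {k} v = subst Side⊎ (join-splitAt n k v) (view (splitAt n v))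
  where
  view : (w : Fin n ⊎ Fin k) → Side⊎ (join n k w)
  view (inj₁ v) = left v
  view (inj₂ v) = right v

⊆-++⁺ : ∀ {p p′ : Subset n} {q q′ : Subset k} → p ⊆ p′ → q ⊆ q′ → p ++ q ⊆ p′ ++ q′
⊆-++⁺ {n} {k} p⊆p′ q⊆q′ {v} v∈ with side n v
... | left  _ = ∈-++⁺ˡ (p⊆p′ (∈-++⁻ˡ v∈))
... | right _ = ∈-++⁺ʳ (q⊆q′ (∈-++⁻ʳ v∈))

⊆-++⁻ : ∀ {S} (p : Subset n) (q : Subset k) → S ⊆ p ++ q →
        ∃[ p′ ] ∃[ q′ ] S ≡ p′ ++ q′ × p′ ⊆ p × q′ ⊆ q
⊆-++⁻ {n} {S = S} _ _ S⊆ with p′ , q′ , refl ← Vec.splitAt n S =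
  p′ , q′ , refl , ∈-++⁻ˡ ∘ S⊆ ∘ ∈-++⁺ˡ , ∈-++⁻ʳ ∘ S⊆ ∘ ∈-++⁺ʳ

⊆⊥⇒≡⊥ : ∀ {p : Subset n} → p ⊆ ⊥ → p ≡ ⊥
⊆⊥⇒≡⊥ p⊆⊥ = ⊆-antisym p⊆⊥ ⊥⊆

⊥++⊥ : ∀ n → ⊥ {n} ++ ⊥ {k} ≡ ⊥
⊥++⊥ zero    = refl
⊥++⊥ (suc n) = cong (outside ∷_) (⊥++⊥ n)

⁅⁆-↑ˡ : ∀ (v : Fin n) → ⁅ v ↑ˡ k ⁆ ≡ ⁅ v ⁆ ++ ⊥
⁅⁆-↑ˡ {suc n} zero = cong (inside ∷_) (sym (⊥++⊥ n))
⁅⁆-↑ˡ (suc v) = cong (outside ∷_) (⁅⁆-↑ˡ v)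

⁅⁆-↑ʳ : ∀ n (v : Fin k) → ⁅ n ↑ʳ v ⁆ ≡ ⊥ ++ ⁅ v ⁆
⁅⁆-↑ʳ zero    v = refl
⁅⁆-↑ʳ (suc n) v = cong (outside ∷_) (⁅⁆-↑ʳ n v)

∪-++ : ∀ (p p′ : Subset n) (q q′ : Subset k) → (p ++ q) ∪ (p′ ++ q′) ≡ (p ∪ p′) ++ (q ∪ q′)
∪-++ []      []        q q′ = refl
∪-++ (_ ∷ p) (_ ∷ p′) q q′ = cong (_ ∷_) (∪-++ p p′ q q′)

∩-++ : ∀ (p p′ : Subset n) (q q′ : Subset k) → (p ++ q) ∩ (p′ ++ q′) ≡ (p ∩ p′) ++ (q ∩ q′)
∩-++ []      []        q q′ = refl
∩-++ (_ ∷ p) (_ ∷ p′) q q′ = cong (_ ∷_) (∩-++ p p′ q q′)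

─-++ : ∀ (p p′ : Subset n) (q q′ : Subset k) → (p ++ q) ─ (p′ ++ q′) ≡ (p ─ p′) ++ (q ─ q′)
─-++ []      []               q q′ = refl
─-++ (_ ∷ p) (inside  ∷ p′) q q′ = cong (_ ∷_) (─-++ p p′ q q′)
─-++ (_ ∷ p) (outside ∷ p′) q q′ = cong (_ ∷_) (─-++ p p′ q q′)

∣p++q∣ : ∀ (p : Subset n) (q : Subset k) → ∣ p ++ q ∣ ≡ ∣ p ∣ + ∣ q ∣
∣p++q∣ []            q = refl
∣p++q∣ (inside  ∷ p) q = cong suc (∣p++q∣ p q)
∣p++q∣ (outside ∷ p) q = ∣p++q∣ p q

embed : ∀ k → Subset n → Subset (n + k)
embed k p = p ++ ⊥

∣embed∣ : ∀ (p : Subset n) → ∣ embed k p ∣ ≡ ∣ p ∣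
∣embed∣ {k = k} p = trans (∣p++q∣ p ⊥) (trans (cong (∣ p ∣ +_) (∣⊥∣≡0 k)) (ℕ.+-identityʳ _))

embed-∪ : ∀ (p q : Subset n) → embed k p ∪ embed k q ≡ embed k (p ∪ q)
embed-∪ p q = trans (∪-++ p q ⊥ ⊥) (cong ((p ∪ q) ++_) (∪-idem ⊥))

embed-∩ : ∀ (p q : Subset n) → embed k p ∩ embed k q ≡ embed k (p ∩ q)
embed-∩ p q = trans (∩-++ p q ⊥ ⊥) (cong ((p ∩ q) ++_) (∩-idem ⊥))

embed-- : ∀ (p : Subset n) m → embed k p - (m ↑ˡ k) ≡ embed k (p - m)
embed-- p m = trans (cong (embed _ p ─_) (⁅⁆-↑ˡ m))
  (trans (─-++ p ⁅ m ⁆ ⊥ ⊥) (cong ((p - m) ++_) (p─⊥≡p ⊥)))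

embed-∪- : ∀ (p q : Subset n) m → (embed k p ∪ embed k q) - (m ↑ˡ k) ≡ embed k ((p ∪ q) - m)
embed-∪- p q m = trans (cong (_- _) (embed-∪ p q)) (embed-- (p ∪ q) m)

embed-mono : ∀ {p q : Subset n} → p ⊆ q → embed k p ⊆ embed k q
embed-mono p⊆q = ⊆-++⁺ p⊆q id

embed-cancel : ∀ {p q : Subset n} → embed k p ⊆ embed k q → p ⊆ q
embed-cancel p⊆q = ∈-++⁻ˡ ∘ p⊆q ∘ ∈-++⁺ˡ

⊆embed⁻ : ∀ {S} (p : Subset n) → S ⊆ embed k p → ∃[ q ] S ≡ embed k q × q ⊆ p
⊆embed⁻ p S⊆
  with p′ , q′ , refl , p′⊆p , q′⊆⊥ ← ⊆-++⁻ p ⊥ S⊆ with refl ← ⊆⊥⇒≡⊥ q′⊆⊥ =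
  p′ , refl , p′⊆p

embed-injective : ∀ {p q : Subset n} → embed k p ≡ embed k q → p ≡ q
embed-injective {p = p} {q} = ++-injectiveˡ p q

↑ʳ∉embed : ∀ (p : Subset n) {v : Fin k} → n ↑ʳ v ∉ embed k p
↑ʳ∉embed p v∈ = ∉⊥ (∈-++⁻ʳ {p = p} v∈)

-- Disjoint union of a complex with a simplex

module _ (Δ : SimplicialComplex) (k : ℕ) where
  open SimplicialComplex Δ renaming (n to N)

  -- No face meets both sides, and `new` admits every subset of the `k` new vertices. The empty set
  -- arises from both constructors.
  data UnionFace : Subset (N + k) → Set where
    old : ∀ {A} → Face A → UnionFace (embed k A)
    new : (B : Subset k) → UnionFace (⊥ {N} ++ B)

  UnionFace⁻ : ∀ {A B} → UnionFace (A ++ B) → (Face A × B ≡ ⊥) ⊎ A ≡ ⊥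
  UnionFace⁻ f = go f refl
    where
    -- Matching cannot unify `A ++ B` with the indices of the constructors, so the index becomes a
    -- variable `S` with an equation.
    go : ∀ {S A B} → UnionFace S → S ≡ A ++ B → (Face A × B ≡ ⊥) ⊎ A ≡ ⊥
    go {A = A} (old {C} C-face) eq with refl ← ++-injectiveˡ C A eq =
      inj₁ (C-face , sym (++-injectiveʳ C A eq))
    go {A = A} (new B) eq = inj₂ (sym (++-injectiveˡ ⊥ A eq))

  UnionFace⁺ : ∀ {A B} → (Face A × B ≡ ⊥) ⊎ A ≡ ⊥ → UnionFace (A ++ B)
  UnionFace⁺ (inj₁ (A-face , refl)) = old A-face
  UnionFace⁺ (inj₂ refl)            = new _

  withSimplex : SimplicialComplex
  withSimplex = record
    { n      = N + k
    ; Face   = UnionFace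
    ; face?  = λ S → let A , B , eq = Vec.splitAt N S in
        subst (Dec ∘ UnionFace) (sym eq)
          (map′ UnionFace⁺ UnionFace⁻
            ((face? A ×-dec ≡-dec _≟ᵇ_ B ⊥) ⊎-dec ≡-dec _≟ᵇ_ A ⊥))
    ; ∅-face = subst UnionFace (⊥++⊥ N) (new ⊥)
    ; vertex = vertex′
    ; down   = down′
    }
    where
    vertex′ : ∀ v → UnionFace ⁅ v ⁆
    vertex′ v with side N v
    ... | left  w = subst UnionFace (sym (⁅⁆-↑ˡ w)) (old (vertex w))
    ... | right w = subst UnionFace (sym (⁅⁆-↑ʳ N w)) (new ⁅ w ⁆)
    down′ : ∀ {F G} → F ⊆ G → UnionFace G → UnionFace F
    down′ F⊆G (old {A} A-face) with B , refl , B⊆A ← ⊆embed⁻ A F⊆G = old (down B⊆A A-face)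
    down′ F⊆G (new B) with p′ , q′ , refl , p′⊆⊥ , _ ← ⊆-++⁻ (⊥ {N}) B F⊆G
      with refl ← ⊆⊥⇒≡⊥ p′⊆⊥ = new q′

  open SimplicialComplex withSimplex using ()
    renaming (Face to Face⁺; HasDimension to HasDimension⁺)

  ι : Subset N → Subset (N + k)
  ι = embed k

  ι-face⁻ : ∀ {A} → Face⁺ (ι A) → Face A
  ι-face⁻ f with UnionFace⁻ f
  ... | inj₁ (A-face , _) = A-face
  ... | inj₂ refl         = ∅-face

  -- `ι` preserves size and commutes with union, intersection and deletion, and every subset of an
  -- embedded set is embedded; so the sets quantified over can be pulled back to `Δ`.
  requirement⁺ : ∀ X {F G m} → Requirement Δ X F G m →
                 Requirement withSimplex X (ι F) (ι G) (m ↑ˡ k)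
  requirement⁺ E {F} {G} req H H⊆ ∣H∣≡
    with C , refl , C⊆ ← ⊆embed⁻ (F ∪ G) (subst (H ⊆_) (embed-∪ F G) H⊆) =
    old (req C C⊆ (trans (sym (∣embed∣ C)) (trans ∣H∣≡ (∣embed∣ F))))
  requirement⁺ mid {F} {G} {m} req e e⊆ ∣e∣≡
    with C , refl , C⊆ ← ⊆embed⁻ ((F ∪ G) - m) (subst (e ⊆_) (embed-∪- F G m) e⊆)
    with C-face , H , H-face , ∣H∣≡ , C⊆H , H⊆ ← req C C⊆ (trans (sym (∣embed∣ C)) ∣e∣≡) =
    old C-face , ι H , old H-face , trans (∣embed∣ H) (trans ∣H∣≡ (sym (∣embed∣ F))) ,
    embed-mono C⊆H , subst (ι H ⊆_) (sym (embed-∪- F G m)) (embed-mono H⊆)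
  requirement⁺ weakly {F} {G} {m} (H , H-face , ∣H∣≡ , H⊆) =
    ι H , old H-face , trans (∣embed∣ H) (trans ∣H∣≡ (sym (∣embed∣ F))) ,
    subst (ι H ⊆_) (sym (embed-∪- F G m)) (embed-mono H⊆)
  requirement⁺ veryWeakly {F} {G} {m} req (∣F∣≡∣G∣ , adj) =
    subst Face⁺ (sym (embed-∪- F G m)) (old (req
      ( trans (sym (∣embed∣ F)) (trans ∣F∣≡∣G∣ (∣embed∣ G))
      , trans (cong suc (sym (trans (cong ∣_∣ (embed-∩ F G)) (∣embed∣ (F ∩ G)))))
              (trans adj (∣embed∣ F)))))
  requirement⁺ clique {F} {G} req e e⊆ ∣e∣≡
    with C , refl , C⊆ ← ⊆embed⁻ (F ∪ G) (subst (e ⊆_) (embed-∪ F G) e⊆) =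
    old (req C C⊆ (trans (sym (∣embed∣ C)) ∣e∣≡))

  requirement⁻ : ∀ X {F G m} → Requirement withSimplex X (ι F) (ι G) (m ↑ˡ k) →
                 Requirement Δ X F G m
  requirement⁻ E {F} {G} req H H⊆ ∣H∣≡ =
    ι-face⁻ (req (ι H) (subst (ι H ⊆_) (sym (embed-∪ F G)) (embed-mono H⊆))
      (trans (∣embed∣ H) (trans ∣H∣≡ (sym (∣embed∣ F)))))
  requirement⁻ mid {F} {G} {m} req e e⊆ ∣e∣≡
    with e-face , H , H-face , ∣H∣≡ , e⊆H , H⊆ ←
      req (ι e) (subst (ι e ⊆_) (sym (embed-∪- F G m)) (embed-mono e⊆)) (trans (∣embed∣ e) ∣e∣≡)
    with C , refl , C⊆ ← ⊆embed⁻ ((F ∪ G) - m) (subst (H ⊆_) (embed-∪- F G m) H⊆) =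
    ι-face⁻ e-face , C , ι-face⁻ H-face ,
    trans (sym (∣embed∣ C)) (trans ∣H∣≡ (∣embed∣ F)) , embed-cancel e⊆H , C⊆
  requirement⁻ weakly {F} {G} {m} (H , H-face , ∣H∣≡ , H⊆)
    with C , refl , C⊆ ← ⊆embed⁻ ((F ∪ G) - m) (subst (H ⊆_) (embed-∪- F G m) H⊆) =
    C , ι-face⁻ H-face , trans (sym (∣embed∣ C)) (trans ∣H∣≡ (∣embed∣ F)) , C⊆
  requirement⁻ veryWeakly {F} {G} {m} req (∣F∣≡∣G∣ , adj) =
    ι-face⁻ (subst Face⁺ (embed-∪- F G m) (req
      ( trans (∣embed∣ F) (trans ∣F∣≡∣G∣ (sym (∣embed∣ G)))
      , trans (cong suc (trans (cong ∣_∣ (embed-∩ F G)) (∣embed∣ (F ∩ G))))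
              (trans adj (sym (∣embed∣ F))))))
  requirement⁻ clique {F} {G} req e e⊆ ∣e∣≡ =
    ι-face⁻ (req (ι e) (subst (ι e ⊆_) (sym (embed-∪ F G)) (embed-mono e⊆))
      (trans (∣embed∣ e) ∣e∣≡))

  -- A set with an old vertex `v` lies in no face of the new simplex, so a facet that contains a
  -- vertex stays maximal.
  scope⁺ : ∀ P {A v} → v ∈ A → scope P Δ A → scope P withSimplex (ι A)
  scope⁺ (skeleton _) _ A-face = old A-face
  scope⁺ (plain _) {A} v∈A (A-face , max) = old A-face , max⁺
    where
    max⁺ : ∀ G → Face⁺ G → ι A ⊆ G → G ≡ ι A
    max⁺ _ (old {C} C-face) A⊆C = cong ι (max C C-face (embed-cancel A⊆C))
    max⁺ _ (new B)          A⊆B = contradiction (∈-++⁻ˡ (A⊆B (∈-++⁺ˡ v∈A))) ∉⊥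

  scope⁻ : ∀ P {A} → scope P withSimplex (ι A) → scope P Δ A
  scope⁻ (skeleton _) f           = ι-face⁻ f
  scope⁻ (plain _)    (f , max) = ι-face⁻ f , λ G G-face A⊆G →
    embed-injective (max (ι G) (old G-face) (embed-mono A⊆G))

  scope⇒Face : ∀ P {S} → scope P withSimplex S → Face⁺ S
  scope⇒Face (plain _)    = proj₁
  scope⇒Face (skeleton _) = id

  hasDimension⁺ : ∀ {d} → k ≡ suc d → (∀ F → Face F → ∣ F ∣ ≤ k) → HasDimension⁺ d
  hasDimension⁺ refl bound = (⊥ {N} ++ ⊤ , new ⊤ , ∣new∣ ⊤ (∣⊤∣≡n k)) , bound⁺
    where
    ∣new∣ : ∀ B {j} → ∣ B ∣ ≡ j → ∣ ⊥ {N} ++ B ∣ ≡ j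
    ∣new∣ B eq = trans (∣p++q∣ (⊥ {N}) B) (trans (cong (_+ ∣ B ∣) (∣⊥∣≡0 N)) eq)
    bound⁺ : ∀ F → Face⁺ F → ∣ F ∣ ≤ k
    bound⁺ _ (old {A} A-face) = subst (_≤ k) (sym (∣embed∣ A)) (bound A A-face)
    bound⁺ _ (new B)          = subst (_≤ k) (sym (∣new∣ B refl)) (∣p∣≤n B)

-- Separation by a labeling and a local obstruction

ChordalUnder : (Δ : SimplicialComplex) → Labeling (SimplicialComplex.n Δ) → Property → Set
ChordalUnder Δ σ P = ∀ F G m → scope P Δ F → scope P Δ G → F ≢ G → ∣ F ∣ ≡ ∣ G ∣ →
  IsMax σ F m → IsMax σ G m → Requirement Δ (kind P) F G m

Obstructed : SimplicialComplex → Property → Set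
Obstructed Δ Q = ∀ m → ∃[ F ] scope Q Δ F × m ∈ F × ∃[ G ] scope Q Δ G × m ∈ G ×
  F ≢ G × ∣ F ∣ ≡ ∣ G ∣ × ¬ Requirement Δ (kind Q) F G m

module _ (Δ : SimplicialComplex) (k : ℕ) where
  open SimplicialComplex Δ renaming (n to N)

  private
    Δ⁺ = withSimplex Δ k

  -- The old vertices keep their numbers in the union, so its identity labeling restricts to that of
  -- `Δ`.
  IsMax⁻ : ∀ {A : Subset N} {m} → IsMax Perm.id (embed k A) (m ↑ˡ k) → IsMax Perm.id A m
  IsMax⁻ {m = m} (m∈ , max) = ∈-++⁻ˡ m∈ , λ v v∈ →
    subst₂ _≤_ (toℕ-↑ˡ v k) (toℕ-↑ˡ m k) (max (v ↑ˡ k) (∈-++⁺ˡ v∈))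

  -- The common vertex `m` puts both faces on the same side. Old pairs inherit their requirement
  -- from `Δ`; in the simplex every subset of the union is a face, which gives E and hence every
  -- kind.
  chordalUnder⁺ : ∀ P → ChordalUnder Δ Perm.id P → ChordalUnder Δ⁺ Perm.id P
  chordalUnder⁺ P ch F G m φF φG F≢G eq maxF maxG =
    go (scope⇒Face Δ k P φF) (scope⇒Face Δ k P φG) (side N m) φF φG F≢G eq maxF maxG
    where
    go : ∀ {F G m} → UnionFace Δ k F → UnionFace Δ k G → Side⊎ {N} m →
         scope P Δ⁺ F → scope P Δ⁺ G → F ≢ G → ∣ F ∣ ≡ ∣ G ∣ →
         IsMax Perm.id F m → IsMax Perm.id G m → Requirement Δ⁺ (kind P) F G m
    go (old {A} _) (old {B} _) (left m) φF φG F≢G eq maxF maxG =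
      requirement⁺ Δ k (kind P) (ch A B m (scope⁻ Δ k P φF) (scope⁻ Δ k P φG)
        (F≢G ∘ cong (embed k)) (trans (sym (∣embed∣ A)) (trans eq (∣embed∣ B)))
        (IsMax⁻ {A} maxF) (IsMax⁻ {B} maxG))
    go (new B) (new C) m φF φG F≢G eq maxF maxG =
      E⇒ Δ⁺ (kind P) _ _ _ (new B) (new C) F≢G eq (proj₁ maxF) (proj₁ maxG)
        λ H H⊆ _ → SimplicialComplex.down Δ⁺ (subst (H ⊆_) new-∪ H⊆) (new (B ∪ C))
      where
      new-∪ : (⊥ ++ B) ∪ (⊥ ++ C) ≡ ⊥ {N} ++ (B ∪ C)
      new-∪ = trans (∪-++ ⊥ ⊥ B C) (cong (_++ (B ∪ C)) (∪-idem ⊥))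
    go (old {A} _) _ (right _) _ _ _ _ maxF _ = contradiction (proj₁ maxF) (↑ʳ∉embed A)
    go _ (old {B} _) (right _) _ _ _ _ _ maxG = contradiction (proj₁ maxG) (↑ʳ∉embed B)
    go (new _) _ (left _)  _ _ _ _ maxF _ = contradiction (∈-++⁻ˡ (proj₁ maxF)) ∉⊥
    go _ (new _) (left _)  _ _ _ _ _ maxG = contradiction (∈-++⁻ˡ (proj₁ maxG)) ∉⊥

  -- New vertices may carry any labels: an embedded set has only old vertices, so the largest label
  -- among the old ones decides.
  embed-max : (σ : Labeling (N + k)) → Fin N →
              ∃[ m ] (∀ {A} → m ∈ A → IsMax σ (embed k A) (m ↑ˡ k))
  embed-max σ v₀ = m , λ {A} m∈A → ∈-++⁺ˡ m∈A , λ v → below v (side N v)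
    where
    label : Fin N → ℕ
    label v = toℕ (σ ⟨$⟩ʳ (v ↑ˡ k))
    m : Fin N
    -- `v₀` is the starting value of `argmax`; it exists because `Δ` has a vertex.
    m = argmax label v₀ (allFin N)
    below : ∀ {A} v → Side⊎ {N} v → v ∈ embed k A → toℕ (σ ⟨$⟩ʳ v) ≤ label m
    below _ (left v)  _  = All.lookup (f[xs]≤f[argmax] {f = label} v₀ (allFin N)) (∈-allFin v)
    below {A} _ (right v) v∈ = contradiction v∈ (↑ʳ∉embed A)

  obstructed⁺ : ∀ Q → Fin N → Obstructed Δ Q → ¬ Chordal Δ⁺ (kind Q) (scope Q Δ⁺)
  obstructed⁺ Q v₀ obstruct (σ , ch)
    with m , isMax ← embed-max σ v₀
    with F , φF , m∈F , G , φG , m∈G , F≢G , eq , ¬req ← obstruct m =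
    ¬req (requirement⁻ Δ k (kind Q) (ch (embed k F) (embed k G) (m ↑ˡ k)
      (scope⁺ Δ k Q m∈F φF) (scope⁺ Δ k Q m∈G φG) (F≢G ∘ embed-injective)
      (trans (∣embed∣ F) (trans eq (sym (∣embed∣ G))))
      (isMax m∈F) (isMax m∈G)))

Separated : Property → Property → Set₁
Separated P Q = ∀ d → 2 ≤ d → Σ SimplicialComplex λ Δ →
  SimplicialComplex.HasDimension Δ d × Satisfies Δ P × ¬ Satisfies Δ Q

separate : ∀ P Q (Δ : SimplicialComplex) → Fin (SimplicialComplex.n Δ) →
           (∀ F → SimplicialComplex.Face Δ F → ∣ F ∣ ≤ 3) →
           ChordalUnder Δ Perm.id P → Obstructed Δ Q → Separated P Q
separate P Q Δ v bound ch obstruct d 2≤d =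
  -- A simplex on `suc d` vertices has dimension `d`; faces of `Δ` have size at most 3, which is at
  -- most `suc d` since 2 ≤ `d`.
  Δ⁺ , hasDimension⁺ Δ (suc d) refl (λ F f → ℕ.≤-trans (bound F f) (s≤s 2≤d)) ,
  Chordal⇒Satisfies Δ⁺ P (Perm.id , chordalUnder⁺ Δ (suc d) P ch) ,
  obstructed⁺ Δ (suc d) Q v obstruct ∘ Satisfies⇒Chordal Δ⁺ Q
  where
  Δ⁺ = withSimplex Δ (suc d)

-- Decision procedures for small complexes

allSubsets? : ∀ {P : Pred (Subset n) 0ℓ} → Decidable P → Dec (∀ S → P S)
allSubsets? P? = map′
  (λ ¬∃ S → decidable-stable (P? S) λ ¬PS → ¬∃ (S , ¬PS))
  (λ ∀P (S , ¬PS) → ¬PS (∀P S))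
  (¬? (anySubset? (¬? ∘ P?)))

_≟ˢ_ : (p q : Subset n) → Dec (p ≡ q)
_≟ˢ_ = ≡-dec _≟ᵇ_

isMax? : (σ : Labeling n) → ∀ F m → Dec (IsMax σ F m)
isMax? σ F m = (m ∈? F) ×-dec all? λ v → (v ∈? F) →-dec (σ ⟨$⟩ʳ v Fin.≤? σ ⟨$⟩ʳ m)

module _ (Δ : SimplicialComplex) where
  open SimplicialComplex Δ renaming (n to N)

  scope? : ∀ P → Decidable (scope P Δ)
  scope? (skeleton _) = face?
  scope? (plain _) F  = face? F ×-dec
    allSubsets? λ G → face? G →-dec ((F ⊆? G) →-dec (G ≟ˢ F))

  requirement? : ∀ X F G m → Dec (Requirement Δ X F G m)
  requirement? E F G m = allSubsets? λ H →
    (H ⊆? F ∪ G) →-dec ((∣ H ∣ ℕ.≟ ∣ F ∣) →-dec face? H)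
  requirement? mid F G m = allSubsets? λ e →
    (e ⊆? (F ∪ G) - m) →-dec ((∣ e ∣ ℕ.≟ 2) →-dec (face? e ×-dec
    anySubset? λ H → face? H ×-dec (∣ H ∣ ℕ.≟ ∣ F ∣) ×-dec (e ⊆? H) ×-dec (H ⊆? (F ∪ G) - m)))
  requirement? weakly F G m = anySubset? λ H →
    face? H ×-dec (∣ H ∣ ℕ.≟ ∣ F ∣) ×-dec (H ⊆? (F ∪ G) - m)
  requirement? veryWeakly F G m =
    ((∣ F ∣ ℕ.≟ ∣ G ∣) ×-dec (suc ∣ F ∩ G ∣ ℕ.≟ ∣ F ∣)) →-dec face? ((F ∪ G) - m)
  requirement? clique F G m = allSubsets? λ e →
    (e ⊆? F ∪ G) →-dec ((∣ e ∣ ℕ.≟ 2) →-dec face? e)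

  -- The quantifiers are reordered so that non-faces are discarded early.
  chordalUnder? : ∀ σ P → Dec (ChordalUnder Δ σ P)
  chordalUnder? σ P = map′
    (λ ch F G m φF φG F≢G eq maxF maxG → ch F φF G φG F≢G eq m maxF maxG)
    (λ ch F φF G φG F≢G eq m maxF maxG → ch F G m φF φG F≢G eq maxF maxG)
    (allSubsets? λ F → scope? P F →-dec allSubsets? λ G → scope? P G →-dec
      (¬? (F ≟ˢ G) →-dec ((∣ F ∣ ℕ.≟ ∣ G ∣) →-dec all? λ m →
      isMax? σ F m →-dec (isMax? σ G m →-dec requirement? (kind P) F G m))))

  obstructed? : ∀ Q → Dec (Obstructed Δ Q)
  obstructed? Q = all? λ m → anySubset? λ F → scope? Q F ×-dec (m ∈? F) ×-dec
    anySubset? λ G → scope? Q G ×-dec (m ∈? G) ×-dec ¬? (F ≟ˢ G) ×-dec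
    (∣ F ∣ ℕ.≟ ∣ G ∣) ×-dec ¬? (requirement? (kind Q) F G m)

  bounded? : Dec (∀ F → Face F → ∣ F ∣ ≤ 3)
  bounded? = allSubsets? λ F → face? F →-dec (∣ F ∣ ≤? 3)

-- The six examples

Generated : List (Subset n) → Pred (Subset n) 0ℓ
Generated Fs S = Any (λ F → S ⊆ F) Fs

generated? : (Fs : List (Subset n)) → Decidable (Generated Fs)
generated? Fs S = any? (S ⊆?_) Fs

generated : ∀ {n} (Fs : List (Subset (suc n))) →
            {True (all? λ v → generated? Fs ⁅ v ⁆)} → SimplicialComplex
generated Fs {cover} = record
  { Face   = Generated Fs
  ; face?  = generated? Fs
  -- The generator that covers vertex 0 also contains the empty set; `Fin (suc n)` guarantees that
  -- vertex.
  ; ∅-face = Any.map {Q = ⊥ ⊆_} (λ _ → ⊥⊆) (toWitness cover zero)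
  ; vertex = toWitness cover
  ; down   = λ {F} {G} F⊆G → Any.map {P = G ⊆_} {Q = F ⊆_} λ G⊆ → ⊆-trans F⊆G G⊆
  }

-- Entries ≥ n are ignored.
⟨_⟩ : List ℕ → Subset n
⟨ vs ⟩ = tabulate λ v → does (toℕ v ∈ᴸ? vs)

-- The `True` arguments are finite checks settled by evaluation. The complex has one vertex more
-- than the value of `n`.
separate-by : ∀ P Q {n} (Fs : List (Subset (suc n))) →
  {cover : True (all? λ v → generated? Fs ⁅ v ⁆)} → let Δ = generated Fs {cover} in
  {True (bounded? Δ)} → {True (chordalUnder? Δ Perm.id P)} → {True (obstructed? Δ Q)} →
  Separated P Q
separate-by P Q Fs {_} {b} {c} {o} =
  separate P Q (generated Fs) zero (toWitness b) (toWitness c) (toWitness o)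

-- 1, 2, 3, 4 is an induced 4-cycle.
E-not-skClique : Separated (plain E) (skeleton clique)
E-not-skClique = separate-by (plain E) (skeleton clique) {4}
  (⟨ 1 ∷ 2 ∷ [] ⟩ ∷ ⟨ 3 ∷ 4 ∷ [] ⟩ ∷ ⟨ 0 ∷ 2 ∷ 3 ∷ [] ⟩ ∷ ⟨ 0 ∷ 1 ∷ 4 ∷ [] ⟩ ∷ [])

-- The cone with apex 0 over the boundary of the triangle 123. Every vertex lies on two facets,
-- whose union contains the non-face 123.
skMid-not-E : Separated (skeleton mid) (plain E)
skMid-not-E = separate-by (skeleton mid) (plain E) {3}
  (⟨ 0 ∷ 1 ∷ 2 ∷ [] ⟩ ∷ ⟨ 0 ∷ 1 ∷ 3 ∷ [] ⟩ ∷ ⟨ 0 ∷ 2 ∷ 3 ∷ [] ⟩ ∷ [])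

-- Three triangles on the edge 01, whose tips 2, 3, 4 span a fourth. At 0 or 1, two of the three
-- leave a non-face such as 123. At a tip, say 2, the facets 012 and 234 require a triangle on 34
-- avoiding 2, but 234 is the only one on 34.
skWeakly-not-mid : Separated (skeleton weakly) (plain mid)
skWeakly-not-mid = separate-by (skeleton weakly) (plain mid) {4}
  (⟨ 0 ∷ 1 ∷ 2 ∷ [] ⟩ ∷ ⟨ 0 ∷ 1 ∷ 3 ∷ [] ⟩ ∷ ⟨ 0 ∷ 1 ∷ 4 ∷ [] ⟩ ∷ ⟨ 2 ∷ 3 ∷ 4 ∷ [] ⟩ ∷ [])

-- The Pasch configuration (any two of its four triples share exactly one point),
-- completed by edges so that the graph is complete.
skVeryWeakly-not-weakly : Separated (skeleton veryWeakly) (plain weakly)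
skVeryWeakly-not-weakly = separate-by (skeleton veryWeakly) (plain weakly) {5}
  (⟨ 0 ∷ 1 ∷ 2 ∷ [] ⟩ ∷ ⟨ 0 ∷ 3 ∷ 4 ∷ [] ⟩ ∷ ⟨ 1 ∷ 3 ∷ 5 ∷ [] ⟩ ∷ ⟨ 2 ∷ 4 ∷ 5 ∷ [] ⟩ ∷
   ⟨ 0 ∷ 5 ∷ [] ⟩ ∷ ⟨ 1 ∷ 4 ∷ [] ⟩ ∷ ⟨ 2 ∷ 3 ∷ [] ⟩ ∷ [])

-- The 5-vertex Möbius strip {i, i+1, i+2} mod 5.
skClique-not-veryWeakly : Separated (skeleton clique) (plain veryWeakly)
skClique-not-veryWeakly = separate-by (skeleton clique) (plain veryWeakly) {4}
  (⟨ 0 ∷ 1 ∷ 2 ∷ [] ⟩ ∷ ⟨ 1 ∷ 2 ∷ 3 ∷ [] ⟩ ∷ ⟨ 2 ∷ 3 ∷ 4 ∷ [] ⟩ ∷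
   ⟨ 0 ∷ 3 ∷ 4 ∷ [] ⟩ ∷ ⟨ 0 ∷ 1 ∷ 4 ∷ [] ⟩ ∷ [])

-- The non-edges are 05, 13 and 23; two triangles at each vertex have a union containing 13 (at 0
-- and 5) or 05 (elsewhere). Facets share a maximum only as 034, 124 with `H` = 012 and as 125, 345
-- with `H` = 124.
weakly-not-clique : Separated (plain weakly) (plain clique)
weakly-not-clique = separate-by (plain weakly) (plain clique) {5}
  (⟨ 0 ∷ 1 ∷ 2 ∷ [] ⟩ ∷ ⟨ 0 ∷ 3 ∷ 4 ∷ [] ⟩ ∷ ⟨ 1 ∷ 2 ∷ 4 ∷ [] ⟩ ∷
   ⟨ 1 ∷ 2 ∷ 5 ∷ [] ⟩ ∷ ⟨ 3 ∷ 4 ∷ 5 ∷ [] ⟩ ∷ [])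

-- The order of the ten properties

⟶*-sound : ∀ {P Q} → Star _⟶_ P Q → ∀ Δ → Satisfies Δ P → Satisfies Δ Q
⟶*-sound ε           Δ = id
⟶*-sound (P⟶R ◅ R⟶Q) Δ = ⟶*-sound R⟶Q Δ ∘ ⟶-sound P⟶R Δ

separated-by-⟶* : ∀ {P P′ Q Q′} → Star _⟶_ P P′ → Star _⟶_ Q′ Q →
                  Separated P Q → Separated P′ Q′
separated-by-⟶* P⟶P′ Q′⟶Q sep d 2≤d with Δ , dim , sat , ¬sat ← sep d 2≤d =
  Δ , dim , ⟶*-sound P⟶P′ Δ sat , ¬sat ∘ ⟶*-sound Q′⟶Q Δ

-- The chain formed by the skeleton properties; the plain properties follow it as far as
-- `veryWeakly`.
data _◁_ : Kind → Kind → Set where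
  E◁mid             : E ◁ mid
  mid◁weakly        : mid ◁ weakly
  weakly◁veryWeakly : weakly ◁ veryWeakly
  veryWeakly◁clique : veryWeakly ◁ clique

E◁* : ∀ X → Star _◁_ E X
E◁* E          = ε
E◁* mid        = E◁mid ◅ ε
E◁* weakly     = E◁mid ◅ mid◁weakly ◅ ε
E◁* veryWeakly = E◁mid ◅ mid◁weakly ◅ weakly◁veryWeakly ◅ ε
E◁* clique     = E◁mid ◅ mid◁weakly ◅ weakly◁veryWeakly ◅ veryWeakly◁clique ◅ ε

◁*clique : ∀ X → Star _◁_ X clique
◁*clique E          = E◁* clique
◁*clique mid        = mid◁weakly ◅ weakly◁veryWeakly ◅ veryWeakly◁clique ◅ ε
◁*clique weakly     = weakly◁veryWeakly ◅ veryWeakly◁clique ◅ ε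
◁*clique veryWeakly = veryWeakly◁clique ◅ ε
◁*clique clique     = ε

successor-unique : ∀ {A B C} → A ◁ B → A ◁ C → B ≡ C
successor-unique E◁mid             E◁mid             = refl
successor-unique mid◁weakly        mid◁weakly        = refl
successor-unique weakly◁veryWeakly weakly◁veryWeakly = refl
successor-unique veryWeakly◁clique veryWeakly◁clique = refl

-- Walks along the chain from a common start run along each other, since every
-- element has at most one successor.
◁*-compare : ∀ {A X Y} → Star _◁_ A X → Star _◁_ A Y →
             Star _◁_ X Y ⊎ ∃[ Z ] Z ◁ X × Star _◁_ Y Z
◁*-compare ε       q       = inj₁ q
◁*-compare (s ◅ p) ε       = inj₂ (unsnoc s p)
  where
  unsnoc : ∀ {A B X} → A ◁ B → Star _◁_ B X → ∃[ Z ] Z ◁ X × Star _◁_ A Z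
  unsnoc s ε = _ , s , ε
  unsnoc s (t ◅ p) with Z , z , q ← unsnoc t p = Z , z , s ◅ q
◁*-compare (s ◅ p) (t ◅ q) with refl ← successor-unique s t = ◁*-compare p q

skeleton⟶* : ∀ {X Y} → Star _◁_ X Y → Star _⟶_ (skeleton X) (skeleton Y)
skeleton⟶* = gmap skeleton step
  where
  step : ∀ {X Y} → X ◁ Y → skeleton X ⟶ skeleton Y
  step E◁mid             = skE⟶skMid
  step mid◁weakly        = skMid⟶skWeakly
  step weakly◁veryWeakly = skWeakly⟶skVery
  step veryWeakly◁clique = skVery⟶skClique

-- The plain chain stops short of clique; Y ◁ Z expresses that Y is not clique.
plain⟶* : ∀ {X Y Z} → Star _◁_ X Y → Y ◁ Z → Star _⟶_ (plain X) (plain Y)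
plain⟶* ε                       _  = ε
plain⟶* (E◁mid ◅ p)             y  = E⟶mid ◅ plain⟶* p y
plain⟶* (mid◁weakly ◅ p)        y  = mid⟶weakly ◅ plain⟶* p y
plain⟶* (weakly◁veryWeakly ◅ p) y  = weakly⟶very ◅ plain⟶* p y
plain⟶* (veryWeakly◁clique ◅ ε) ()

-- One example per link suffices: a kind strictly before `X` implies its predecessor `Z`, so it
-- inherits the separation.
skeleton-not-predecessor : ∀ {Z X} → Z ◁ X → Separated (skeleton X) (plain Z)
skeleton-not-predecessor E◁mid             = skMid-not-E
skeleton-not-predecessor mid◁weakly        = skWeakly-not-mid
skeleton-not-predecessor weakly◁veryWeakly = skVeryWeakly-not-weakly
skeleton-not-predecessor veryWeakly◁clique = skClique-not-veryWeakly

plain-E⟶* : ∀ X → Star _⟶_ (plain E) (plain X)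
plain-E⟶* E          = ε
plain-E⟶* mid        = E⟶mid ◅ ε
plain-E⟶* weakly     = E⟶mid ◅ mid⟶weakly ◅ ε
plain-E⟶* veryWeakly = E⟶mid ◅ mid⟶weakly ◅ weakly⟶very ◅ ε
plain-E⟶* clique     = E⟶mid ◅ mid⟶clique ◅ ε

-- Here the plain order leaves the chain: `clique` is reached from `mid` by a side branch, and not
-- from `weakly` or `veryWeakly`.
plain-clique : ∀ X → Star _⟶_ (plain X) (plain clique) ⊎ Separated (plain X) (plain clique)
plain-clique E          = inj₁ (E⟶mid ◅ mid⟶clique ◅ ε)
plain-clique mid        = inj₁ (mid⟶clique ◅ ε)
plain-clique weakly     = inj₂ weakly-not-clique
plain-clique veryWeakly = inj₂ (separated-by-⟶* (weakly⟶very ◅ ε) (ε {x = plain clique})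
  weakly-not-clique)
plain-clique clique     = inj₁ ε

implied-or-separated : ∀ P Q → Star _⟶_ P Q ⊎ Separated P Q
-- The strongest plain property fails to give the weakest skeleton property, which settles all these
-- pairs at once.
implied-or-separated (plain X) (skeleton Y) =
  inj₂ (separated-by-⟶* (plain-E⟶* X) (skeleton⟶* (◁*clique Y)) E-not-skClique)
implied-or-separated (skeleton X) (skeleton Y) with ◁*-compare (E◁* X) (E◁* Y)
... | inj₁ X◁*Y = inj₁ (skeleton⟶* X◁*Y)
... | inj₂ (Z , Z◁X , Y◁*Z) = inj₂ (separated-by-⟶* ε
  (skeleton⟶plain Y ◅ plain⟶* Y◁*Z Z◁X) (skeleton-not-predecessor Z◁X))
implied-or-separated (skeleton X) (plain Y) with ◁*-compare (E◁* X) (E◁* Y)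
... | inj₁ X◁*Y = inj₁ (skeleton⟶* X◁*Y ◅◅ skeleton⟶plain Y ◅ ε)
... | inj₂ (Z , Z◁X , Y◁*Z) = inj₂ (separated-by-⟶* ε
  (plain⟶* Y◁*Z Z◁X) (skeleton-not-predecessor Z◁X))
implied-or-separated (plain X) (plain Y) with ◁*-compare (E◁* X) (E◁* Y)
... | inj₂ (Z , Z◁X , Y◁*Z) = inj₂ (separated-by-⟶* (skeleton⟶plain X ◅ ε)
  (plain⟶* Y◁*Z Z◁X) (skeleton-not-predecessor Z◁X))
... | inj₁ X◁*Y = towards Y X◁*Y
  where
  towards : ∀ Y → Star _◁_ X Y →
            Star _⟶_ (plain X) (plain Y) ⊎ Separated (plain X) (plain Y)
  towards E          p = inj₁ (plain⟶* p E◁mid)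
  towards mid        p = inj₁ (plain⟶* p mid◁weakly)
  towards weakly     p = inj₁ (plain⟶* p weakly◁veryWeakly)
  towards veryWeakly p = inj₁ (plain⟶* p veryWeakly◁clique)
  towards clique     _ = plain-clique X

◅⇒TransClosure : ∀ {P Q R} → P ⟶ Q → Star _⟶_ Q R → TransClosure _⟶_ P R
◅⇒TransClosure s ε       = [ s ]
◅⇒TransClosure s (t ◅ p) = s ∷ ◅⇒TransClosure t p

theorem15 :
    (∀ P Q → P ⟶ Q → ∀ Δ → Satisfies Δ P → Satisfies Δ Q)
    × (∀ (d : ℕ) → 2 ≤ d → ∀ P Q → P ≢ Q → ¬ TransClosure _⟶_ P Q →
        Σ SimplicialComplex λ Δ →
          SimplicialComplex.HasDimension Δ d × Satisfies Δ P × ¬ Satisfies Δ Q)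
theorem15 = (λ _ _ → ⟶-sound) , separation
  where
  separation : ∀ d → 2 ≤ d → ∀ P Q → P ≢ Q → ¬ TransClosure _⟶_ P Q →
    Σ SimplicialComplex λ Δ →
      SimplicialComplex.HasDimension Δ d × Satisfies Δ P × ¬ Satisfies Δ Q
  separation d 2≤d P Q P≢Q ¬P⟶⁺Q with implied-or-separated P Q
  ... | inj₂ sep     = sep d 2≤d
  ... | inj₁ ε       = contradiction refl P≢Q
  ... | inj₁ (s ◅ p) = contradiction (◅⇒TransClosure s p) ¬P⟶⁺Q
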